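{- Let $x_1,\dots,x_N \in [-1,1]^d$ with labels $y_1,\dots,y_N \in \{ -1,1\}$, let $\lambda > 0$, and let $F(\beta) = \frac{1}{N}\sum_{i=1}^N \max(0, 1 - y_i \beta\cdot x_i) + \lambda\|\beta\|_2^2$, with $\beta^* = \arg\min_{\beta\in\mathbb{R}^d} F(\beta)$. Let $\mathcal K$ be the ball of radius $\frac{\sqrt d}{2\lambda}$ centered at the origin. Starting from $\beta^{(0)} = 0$, perform projected gradient descent $\beta^{(t)} = \Pi_{\mathcal K}(\beta^{(t-1)} - \eta_t \nabla F(\beta^{(t-1)}))$ with $\eta_t = \frac{1}{8\lambda\sqrt{dt}}$, and let $\widehat\beta_s = \frac{1}{s}\sum_{t=0}^{s-1}\beta^{(t)}$. Then after $T-1$ iterations, $$F(\widehat\beta_T) - F(\beta^*) \le \frac{4 d^{3/2}}{\lambda\sqrt T}.$$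
   Context: $\Pi_{\mathcal K}(\alpha) = \arg\min_{\beta\in\mathcal K}\|\alpha-\beta\|_2$. The gradient used is $\nabla F(\beta) = 2\lambda\beta - \frac{1}{N}\sum_{i:\ y_i\beta\cdot x_i \le 1} y_i x_i$ (the subgradient that counts points lying exactly on the hinge). -}

module Defs where

open import Level using (0ℓ)
open import Algebra.Bundles using (CommutativeRing)
import Algebra.Construct.NaturalChoice.Max as NaturalMax
import Algebra.Properties.Ring as RingProperties
import Algebra.Properties.Semiring.Mult as SemiringMult
import Algebra.Properties.Semiring.Sum as SemiringSum
open import Algebra.Structures using (IsCommutativeRing)
open import Data.Fin.Base using (Fin; toℕ)
open import Data.Nat.Base as ℕ using (ℕ; suc)
open import Data.Product.Base using (∃; _×_; _,_; proj₁; proj₂)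
open import Data.Sum.Base using (inj₁; inj₂)
open import Data.Vec.Functional using (Vector)
open import Data.Bool.Base using (if_then_else_)
open import Relation.Binary.Bundles using (TotalOrder)
open import Relation.Binary.Structures using (IsDecTotalOrder)
open import Relation.Nullary using (¬_; does)
open import Relation.Unary using (Pred)

-- The real numbers, axiomatised as a Dedekind-complete ordered field in the
-- sense of classical mathematics: the order is total and decidable, and every
-- inhabited set that is bounded above has a least upper bound.

record Reals : Set₁ where
  infix  8 _⁻¹
  infix  8 -_
  infixl 7 _*_
  infixl 6 _+_
  infix  4 _≈_ _≤_
  field
    ℝ    : Set
    _≈_  : ℝ → ℝ → Set
    _≤_  : ℝ → ℝ → Set
    _+_  : ℝ → ℝ → ℝ
    _*_  : ℝ → ℝ → ℝ
    -_   : ℝ → ℝ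
    0#   : ℝ
    1#   : ℝ
    -- The value at 0# is left unspecified.
    _⁻¹  : ℝ → ℝ

    isCommutativeRing : IsCommutativeRing _≈_ _+_ _*_ -_ 0# 1#
    0≉1               : ¬ (0# ≈ 1#)
    *-inverseʳ        : ∀ x → ¬ (x ≈ 0#) → x * x ⁻¹ ≈ 1#

    isDecTotalOrder   : IsDecTotalOrder _≈_ _≤_
    +-monoˡ-≤         : ∀ z {x y} → x ≤ y → x + z ≤ y + z
    *-nonNeg          : ∀ {x y} → 0# ≤ x → 0# ≤ y → 0# ≤ x * y

  IsUpperBound : Pred ℝ 0ℓ → ℝ → Set
  IsUpperBound P b = ∀ x → P x → x ≤ b

  IsLub : Pred ℝ 0ℓ → ℝ → Set
  IsLub P s = IsUpperBound P s × (∀ b → IsUpperBound P b → s ≤ b)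

  field
    complete : ∀ (P : Pred ℝ 0ℓ) → ∃ P → ∃ (IsUpperBound P) → ∃ (IsLub P)

  commutativeRing : CommutativeRing 0ℓ 0ℓ
  commutativeRing = record { isCommutativeRing = isCommutativeRing }

  open IsDecTotalOrder isDecTotalOrder public
    using (_≤?_; isTotalOrder; total; ≤-respˡ-≈; ≤-respʳ-≈)
    renaming (_≟_ to _≈?_; refl to ≤-refl; reflexive to ≤-reflexive;
              trans to ≤-trans; antisym to ≤-antisym)

  totalOrder : TotalOrder 0ℓ 0ℓ 0ℓ
  totalOrder = record { isTotalOrder = isTotalOrder }

  open CommutativeRing commutativeRing public
    using (_-_; semiring; ring; setoid; refl; sym; trans; +-cong; +-congˡ;
           +-congʳ; +-assoc; +-comm; +-identityˡ; +-identityʳ; -‿inverseʳ;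
           *-cong; *-congˡ; *-congʳ; *-comm; *-identityˡ; *-identityʳ; zeroˡ;
           distribˡ; distribʳ)

  open NaturalMax totalOrder public using (_⊔_; x≤x⊔y; x≤y⊔x)

  open SemiringSum semiring public using (sum)
  open SemiringMult semiring public using () renaming (_×_ to _·_)

  infix  4 _<_
  infixl 7 _/_

  _<_ : ℝ → ℝ → Set
  x < y = x ≤ y × ¬ (x ≈ y)

  _/_ : ℝ → ℝ → ℝ
  x / y = x * y ⁻¹

  fromℕ : ℕ → ℝ
  fromℕ n = n · 1#

  sub-nonNeg : ∀ {x y} → x ≤ y → 0# ≤ y - x
  sub-nonNeg {x} x≤y = ≤-respˡ-≈ (-‿inverseʳ x) (+-monoˡ-≤ (- x) x≤y)

  nonNeg-sub : ∀ {x y} → 0# ≤ y - x → x ≤ y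
  nonNeg-sub {x} {y} 0≤y-x =
    ≤-respʳ-≈ (trans (+-assoc y (- x) x)
                (trans (+-congˡ (CommutativeRing.-‿inverseˡ commutativeRing x))
                       (+-identityʳ y)))
      (≤-respˡ-≈ (+-identityˡ x) (+-monoˡ-≤ x 0≤y-x))

  1-nonNeg : 0# ≤ 1#
  1-nonNeg with total 0# 1#
  ... | inj₁ 0≤1 = 0≤1
  ... | inj₂ 1≤0 = ≤-respʳ-≈ sq (*-nonNeg 0≤-1 0≤-1)
    where
    open RingProperties ring using (-‿distribˡ-*; -‿involutive)
    0≤-1 : 0# ≤ - 1#
    0≤-1 = ≤-respʳ-≈ (+-identityˡ (- 1#)) (sub-nonNeg 1≤0)
    sq : - 1# * - 1# ≈ 1#
    sq = trans (sym (-‿distribˡ-* 1# (- 1#)))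
           (trans (CommutativeRing.-‿cong commutativeRing (*-identityˡ (- 1#)))
                  (-‿involutive 1#))

  x≤x² : ∀ {x} → 1# ≤ x → x ≤ x * x
  x≤x² {x} 1≤x = nonNeg-sub (≤-respʳ-≈ expand
                   (*-nonNeg (≤-trans 1-nonNeg 1≤x) (sub-nonNeg 1≤x)))
    where
    open RingProperties ring using (-‿distribʳ-*)
    expand : x * (x - 1#) ≈ x * x - x
    expand = trans (distribˡ x x (- 1#))
      (+-congˡ (trans (sym (-‿distribʳ-* x 1#))
                      (CommutativeRing.-‿cong commutativeRing (*-identityʳ x))))

  SqBelow : ℝ → Pred ℝ 0ℓ
  SqBelow a x = x * x ≤ 0# ⊔ a

  sqBelow-inhabited : ∀ a → ∃ (SqBelow a)
  sqBelow-inhabited a = 0# , ≤-respˡ-≈ (sym (zeroˡ 0#)) (x≤x⊔y 0# a)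

  sqBelow-bounded : ∀ a → ∃ (IsUpperBound (SqBelow a))
  sqBelow-bounded a = 1# ⊔ (0# ⊔ a) , bound
    where
    bound : IsUpperBound (SqBelow a) (1# ⊔ (0# ⊔ a))
    bound x x²≤ with total x 1#
    ... | inj₁ x≤1 = ≤-trans x≤1 (x≤x⊔y 1# (0# ⊔ a))
    ... | inj₂ 1≤x = ≤-trans (x≤x² 1≤x) (≤-trans x²≤ (x≤y⊔x 1# (0# ⊔ a)))

  √-lub : ∀ a → ∃ (IsLub (SqBelow a))
  √-lub a = complete (SqBelow a) (sqBelow-inhabited a) (sqBelow-bounded a)

  -- For a ≥ 0 this is the usual square root; for a < 0 it is 0.
  √ : ℝ → ℝ
  √ a = proj₁ (√-lub a)

module Euclidean (R : Reals) where
  open Reals R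

  ℝ^ : ℕ → Set
  ℝ^ d = Vector ℝ d

  module _ {d : ℕ} where

    infix  4 _≋_
    infixl 6 _⊟_
    infixl 7 _⊛_ _∙_

    𝟎 : ℝ^ d
    𝟎 _ = 0#

    _≋_ : ℝ^ d → ℝ^ d → Set
    u ≋ v = ∀ j → u j ≈ v j

    _⊟_ : ℝ^ d → ℝ^ d → ℝ^ d
    (u ⊟ v) j = u j - v j

    _⊛_ : ℝ → ℝ^ d → ℝ^ d
    (a ⊛ v) j = a * v j

    vsum : ∀ {n} → (Fin n → ℝ^ d) → ℝ^ d
    vsum v j = sum (λ i → v i j)

    _∙_ : ℝ^ d → ℝ^ d → ℝ
    u ∙ v = sum (λ j → u j * v j)

    ‖_‖ : ℝ^ d → ℝ
    ‖ v ‖ = √ (v ∙ v)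

    Ball : ℝ → Pred (ℝ^ d) 0ℓ
    Ball r v = ‖ v ‖ ≤ r

    IsArgMin : Pred (ℝ^ d) 0ℓ → (ℝ^ d → ℝ) → ℝ^ d → Set
    IsArgMin K f p = K p × (∀ q → K q → f p ≤ f q)

    IsProjection : Pred (ℝ^ d) 0ℓ → ℝ^ d → ℝ^ d → Set
    IsProjection K α = IsArgMin K (λ β → ‖ α ⊟ β ‖)

module SVM (R : Reals) where
  open Reals R
  open Euclidean R

  module _ {N d : ℕ} (x : Fin N → ℝ^ d) (y : Fin N → ℝ) (lam : ℝ) where

    F : ℝ^ d → ℝ
    F β = 1# / fromℕ N * sum (λ i → 0# ⊔ (1# - y i * (β ∙ x i)))
          + lam * (‖ β ‖ * ‖ β ‖)

    ∇F : ℝ^ d → ℝ^ d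
    ∇F β = ((fromℕ 2 * lam) ⊛ β)
           ⊟ ((1# / fromℕ N) ⊛
              vsum (λ i → if does (y i * (β ∙ x i) ≤? 1#) then y i ⊛ x i else 𝟎))

    𝒦 : Pred (ℝ^ d) 0ℓ
    𝒦 = Ball (√ (fromℕ d) / (fromℕ 2 * lam))

    η : ℕ → ℝ
    η t = 1# / (fromℕ 8 * lam * √ (fromℕ (d ℕ.* t)))

    -- A relational rendering of the iteration; the projection onto 𝒦 is
    -- unique, so the iterates are determined up to _≋_.
    record IsProjectedGD (β : ℕ → ℝ^ d) : Set where
      field
        start : β 0 ≋ 𝟎
        step  : ∀ t → IsProjection 𝒦 (β t ⊟ (η (suc t) ⊛ ∇F (β t))) (β (suc t))

  module _ {d : ℕ} where

    average : (ℕ → ℝ^ d) → ℕ → ℝ^ d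
    average β s = (1# / fromℕ s) ⊛ vsum {n = s} (λ t → β (toℕ t))

{-# OPTIONS --safe #-}

-- F is 2λ-strongly convex in the sense that its hinge-counting gradient satisfies
-- F v ≥ F β + ∇F β · (v − β) + λ‖v − β‖², and ‖∇F‖² ≤ 4d on 𝒦. Put κ t = 1/η t = 8λ√(dt),
-- D² = d/λ² (the squared diameter of 𝒦) and, for u in 𝒦, Φ t = κ t (D² − ‖β t − u‖²).
-- Projected steps satisfy 2 (F (β t) − F u) ≤ Φ (t + 1) − Φ t: the noise η‖∇F‖² of a step is
-- absorbed by (κ (t + 1) − κ t)(D² − ‖β t − u‖²) + 2λ‖β t − u‖², since both κ (t + 1) − κ t
-- and 2λ are at least 2λ/√(t + 1). The sum telescopes to at most κ T D² = 8 d^{3/2}√T/λ,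
-- and convexity passes to the average. As a comparison point, u = β* rescaled into 𝒦 serves,
-- because that rescaling does not increase F.

module Submission where

open import Data.Nat.Base using (ℕ; NonZero)
open import Data.Fin.Base using (Fin)
open import Data.Product.Base using (_×_)
open import Data.Sum.Base using (_⊎_)
open import Relation.Unary using (U)
open import Defs

open import Algebra.Bundles using (CommutativeRing)
import Algebra.Construct.NaturalChoice.Max as NaturalMax
import Algebra.Properties.Ring as RingProperties
import Algebra.Properties.Semiring.Mult as SemiringMult
import Algebra.Properties.Semiring.Sum as SemiringSum
import Algebra.Solver.Ring as RingSolver
open import Algebra.Solver.Ring.AlmostCommutativeRing
  using (_-Raw-AlmostCommutative⟶_; Induced-equivalence; fromCommutativeRing)
open import Data.Bool.Base using (true; false; if_then_else_)
open import Data.Empty using (⊥-elim)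
open import Data.Fin.Base using (toℕ; zero; suc)
open import Data.Integer.Base as ℤ using (ℤ; +_; -[1+_]; _⊖_)
import Data.Integer.Properties as ℤ
open import Data.Maybe.Base using (map)
open import Data.Nat.Base as ℕ using (zero; suc)
open import Data.Product.Base using (_,_; proj₁; proj₂; ∃)
open import Data.Sum.Base using (inj₁; inj₂)
open import Level using (0ℓ)
open import Relation.Binary.Consequences using (dec⇒weaklyDec)
open import Relation.Binary.Definitions using (WeaklyDecidable)
import Relation.Binary.PropositionalEquality.Core as ≡
import Relation.Binary.Reasoning.Setoid as SetoidReasoning
open import Relation.Nullary using (¬_; yes; no; does)
open import Relation.Unary using (Pred)

-- Ring solver for a commutative ring, with integer coefficients.

module IntegerCoefficients {c ℓ} (R : CommutativeRing c ℓ) where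
  open CommutativeRing R
  open RingProperties ring using (-0#≈0#; -‿+-comm; -‿involutive; -‿distribˡ-*; -‿distribʳ-*)
  open SemiringMult semiring using (×-homo-+; ×1-homo-*) renaming (_×_ to _·_)
  open SetoidReasoning setoid

  -- The clause for 1 makes the solver's literal one definitionally 1# rather than 1# + 0#.
  fromℤ : ℤ → Carrier
  fromℤ (+ 1)    = 1#
  fromℤ (+ n)    = n · 1#
  fromℤ -[1+ n ] = - (suc n · 1#)

  fromℤ-+ : ∀ n → fromℤ (+ n) ≈ n · 1#
  fromℤ-+ 0             = refl
  fromℤ-+ 1             = sym (+-identityʳ 1#)
  fromℤ-+ (suc (suc n)) = refl

  fromℤ-neg : ∀ i → fromℤ (ℤ.- i) ≈ - fromℤ i
  fromℤ-neg (+ 0)             = sym -0#≈0#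
  fromℤ-neg (+ 1)             = -‿cong (+-identityʳ 1#)
  fromℤ-neg (+ (suc (suc n))) = refl
  fromℤ-neg -[1+ n ]          = trans (fromℤ-+ (suc n)) (sym (-‿involutive _))

  fromℤ-⊖ : ∀ m n → fromℤ (m ⊖ n) ≈ m · 1# + - (n · 1#)
  fromℤ-⊖ m       zero    = trans (fromℤ-+ m) (sym (trans (+-congˡ -0#≈0#) (+-identityʳ _)))
  fromℤ-⊖ zero    (suc n) = sym (+-identityˡ _)
  fromℤ-⊖ (suc m) (suc n) = begin
    fromℤ (suc m ⊖ suc n)                     ≡⟨ ≡.cong fromℤ (ℤ.[1+m]⊖[1+n]≡m⊖n m n) ⟩
    fromℤ (m ⊖ n)                             ≈⟨ fromℤ-⊖ m n ⟩
    m · 1# + - (n · 1#)                       ≈⟨ +-congʳ (+-identityʳ _) ⟨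
    m · 1# + 0# + - (n · 1#)                  ≈⟨ +-congʳ (+-congˡ (-‿inverseʳ 1#)) ⟨
    m · 1# + (1# + - 1#) + - (n · 1#)         ≈⟨ +-congʳ (+-assoc _ _ _) ⟨
    m · 1# + 1# + - 1# + - (n · 1#)           ≈⟨ +-assoc _ _ _ ⟩
    m · 1# + 1# + (- 1# + - (n · 1#))         ≈⟨ +-cong (+-comm _ _) (-‿+-comm _ _) ⟩
    (1# + m · 1#) + - (1# + n · 1#)           ∎

  fromℤ-homo-+ : ∀ i j → fromℤ (i ℤ.+ j) ≈ fromℤ i + fromℤ j
  fromℤ-homo-+ (+ m) (+ n) = begin
    fromℤ (+ (m ℕ.+ n))        ≈⟨ fromℤ-+ (m ℕ.+ n) ⟩
    (m ℕ.+ n) · 1#             ≈⟨ ×-homo-+ 1# m n ⟩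
    m · 1# + n · 1#            ≈⟨ +-cong (fromℤ-+ m) (fromℤ-+ n) ⟨
    fromℤ (+ m) + fromℤ (+ n)  ∎
  fromℤ-homo-+ (+ m) -[1+ n ] = trans (fromℤ-⊖ m (suc n)) (+-congʳ (sym (fromℤ-+ m)))
  fromℤ-homo-+ -[1+ m ] (+ n) =
    trans (fromℤ-⊖ n (suc m)) (trans (+-comm _ _) (+-congˡ (sym (fromℤ-+ n))))
  fromℤ-homo-+ -[1+ m ] -[1+ n ] = begin
    - (suc (suc (m ℕ.+ n)) · 1#)       ≈⟨ -‿cong (trans (+-congˡ (×-homo-+ 1# (suc m) n)) (x+[y+z]≈y+[x+z] _ _ _)) ⟩
    - (suc m · 1# + suc n · 1#)        ≈⟨ -‿+-comm _ _ ⟨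
    - (suc m · 1#) + - (suc n · 1#)    ∎
    where
    x+[y+z]≈y+[x+z] : ∀ x y z → x + (y + z) ≈ y + (x + z)
    x+[y+z]≈y+[x+z] x y z = trans (sym (+-assoc x y z)) (trans (+-congʳ (+-comm x y)) (+-assoc y x z))

  -- A negative second factor reduces to a nonnegative one by pulling the sign out on both sides. A
  -- negative first factor is reduced to this case in the same way in `fromℤ-homo-*`.
  fromℤ-homo-*⁺ : ∀ m j → fromℤ (+ m ℤ.* j) ≈ m · 1# * fromℤ j
  fromℤ-homo-*⁺ m (+ n) = begin
    fromℤ (+ m ℤ.* + n)        ≡⟨ ≡.cong fromℤ (ℤ.pos-* m n) ⟨
    fromℤ (+ (m ℕ.* n))        ≈⟨ fromℤ-+ (m ℕ.* n) ⟩
    (m ℕ.* n) · 1#             ≈⟨ ×1-homo-* m n ⟩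
    m · 1# * n · 1#            ≈⟨ *-congˡ (fromℤ-+ n) ⟨
    m · 1# * fromℤ (+ n)       ∎
  fromℤ-homo-*⁺ m -[1+ n ] = begin
    fromℤ (+ m ℤ.* -[1+ n ])          ≡⟨ ≡.cong fromℤ (ℤ.neg-distribʳ-* (+ m) (+ suc n)) ⟨
    fromℤ (ℤ.- (+ m ℤ.* + suc n))     ≈⟨ fromℤ-neg (+ m ℤ.* + suc n) ⟩
    - fromℤ (+ m ℤ.* + suc n)         ≈⟨ -‿cong (fromℤ-homo-*⁺ m (+ suc n)) ⟩
    - (m · 1# * fromℤ (+ suc n))      ≈⟨ -‿distribʳ-* _ _ ⟩
    m · 1# * - fromℤ (+ suc n)        ≈⟨ *-congˡ (-‿cong (fromℤ-+ (suc n))) ⟩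
    m · 1# * - (suc n · 1#)           ∎

  fromℤ-homo-* : ∀ i j → fromℤ (i ℤ.* j) ≈ fromℤ i * fromℤ j
  fromℤ-homo-* (+ m) j = trans (fromℤ-homo-*⁺ m j) (*-congʳ (sym (fromℤ-+ m)))
  fromℤ-homo-* -[1+ m ] j = begin
    fromℤ (-[1+ m ] ℤ.* j)            ≡⟨ ≡.cong fromℤ (ℤ.neg-distribˡ-* (+ suc m) j) ⟨
    fromℤ (ℤ.- (+ suc m ℤ.* j))       ≈⟨ fromℤ-neg (+ suc m ℤ.* j) ⟩
    - fromℤ (+ suc m ℤ.* j)           ≈⟨ -‿cong (fromℤ-homo-*⁺ (suc m) j) ⟩
    - (suc m · 1# * fromℤ j)          ≈⟨ -‿distribˡ-* _ _ ⟩
    - (suc m · 1#) * fromℤ j          ∎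

  morphism : ℤ.+-*-rawRing -Raw-AlmostCommutative⟶ fromCommutativeRing R
  morphism = record
    { ⟦_⟧    = fromℤ
    ; +-homo = fromℤ-homo-+
    ; *-homo = fromℤ-homo-*
    ; -‿homo = fromℤ-neg
    ; 0-homo = refl
    ; 1-homo = refl
    }

  -- Weak decidability asks only for soundness: equal integers have equal images, while nothing is
  -- claimed about distinct integers.
  _fromℤ≟_ : WeaklyDecidable (Induced-equivalence morphism)
  i fromℤ≟ j = map (λ i≡j → reflexive (≡.cong fromℤ i≡j)) (dec⇒weaklyDec ℤ._≟_ i j)

  open RingSolver ℤ.+-*-rawRing (fromCommutativeRing R) morphism _fromℤ≟_
    public using (solve; con; _:+_; _:*_; _:-_; :-_; _:=_)

-- Inequalities in an ordered field.

module OrderedField (R : Reals) where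
  open Reals R
  open IntegerCoefficients commutativeRing public using (solve; con; _:+_; _:*_; _:-_; :-_; _:=_)
  open CommutativeRing commutativeRing public using (-‿cong)
  open SemiringMult semiring using (×1-homo-*)
  open NaturalMax totalOrder public using (⊔-lub)

  -- Inequalities are proved by certificates: the ring solver rewrites y - x as a sum of
  -- products of nonnegative expressions.
  certify : ∀ {x y e} → y - x ≈ e → 0# ≤ e → x ≤ y
  certify y-x≈e 0≤e = nonNeg-sub (≤-respʳ-≈ (sym y-x≈e) 0≤e)

  infixl 6 _⊕_
  infixl 7 _⊗_

  _⊕_ : ∀ {x y} → 0# ≤ x → 0# ≤ y → 0# ≤ x + y
  _⊕_ {x} {y} 0≤x 0≤y =
    ≤-trans 0≤y (certify (solve 2 (λ a b → a :+ b :- b := a) refl x y) 0≤x)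

  _⊗_ : ∀ {x y} → 0# ≤ x → 0# ≤ y → 0# ≤ x * y
  _⊗_ = *-nonNeg

  -- An equation is used in a certificate as a summand with an arbitrary multiplier.
  *-null : ∀ k {x y} → x ≈ y → 0# ≤ k * (x - y)
  *-null k {x} {y} x≈y = ≤-reflexive (sym
    (trans (*-congˡ (trans (+-congʳ x≈y) (-‿inverseʳ y))) (trans (*-comm k 0#) (zeroˡ k))))

  fromℕ-nonNeg : ∀ n → 0# ≤ fromℕ n
  fromℕ-nonNeg zero    = ≤-refl
  fromℕ-nonNeg (suc n) = 1-nonNeg ⊕ fromℕ-nonNeg n

  1≤fromℕ : ∀ n → .{{NonZero n}} → 1# ≤ fromℕ n
  1≤fromℕ (suc n) = certify
    (solve 1 (λ m → con (+ 1) :+ m :- con (+ 1) := m) refl (fromℕ n)) (fromℕ-nonNeg n)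

  fromℕ-* : ∀ m n → fromℕ (m ℕ.* n) ≈ fromℕ m * fromℕ n
  fromℕ-* = ×1-homo-*

  ≰⇒> : ∀ {x y} → ¬ x ≤ y → y < x
  ≰⇒> {x} {y} x≰y with total x y
  ... | inj₁ x≤y = ⊥-elim (x≰y x≤y)
  ... | inj₂ y≤x = y≤x , λ y≈x → x≰y (≤-reflexive (sym y≈x))

  <⇒≱ : ∀ {x y} → x < y → ¬ y ≤ x
  <⇒≱ (x≤y , x≉y) y≤x = x≉y (≤-antisym x≤y y≤x)

  <-≤-trans : ∀ {x y z} → x < y → y ≤ z → x < z
  <-≤-trans x<y y≤z =
    ≤-trans (proj₁ x<y) y≤z , λ x≈z → <⇒≱ x<y (≤-trans y≤z (≤-reflexive (sym x≈z)))

  sub-pos : ∀ {x y} → x < y → 0# < y - x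
  sub-pos {x} {y} x<y = sub-nonNeg (proj₁ x<y) , λ 0≈y-x → <⇒≱ x<y (certify
    (solve 2 (λ a b → a :- b := con (+ 0) :+ con (+ 1) :* (con (+ 0) :- (b :- a))) refl x y)
    (≤-refl ⊕ *-null 1# 0≈y-x))

  0<1 : 0# < 1#
  0<1 = 1-nonNeg , 0≉1

  0<2 : 0# < fromℕ 2
  0<2 = <-≤-trans 0<1 (1≤fromℕ 2)

  x*x-nonNeg : ∀ x → 0# ≤ x * x
  x*x-nonNeg x with total 0# x
  ... | inj₁ 0≤x = 0≤x ⊗ 0≤x
  ... | inj₂ x≤0 = ≤-respʳ-≈
    (solve 1 (λ a → (con (+ 0) :- a) :* (con (+ 0) :- a) := a :* a) refl x)
    (sub-nonNeg x≤0 ⊗ sub-nonNeg x≤0)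

  *-inverse : ∀ {x} → 0# < x → x * x ⁻¹ ≈ 1#
  *-inverse {x} (_ , 0≉x) = *-inverseʳ x (λ x≈0 → 0≉x (sym x≈0))

  -- The inverse equals `x * (x ⁻¹ * x ⁻¹)`, a positive number times a square.
  ⁻¹-nonNeg : ∀ {x} → 0# < x → 0# ≤ x ⁻¹
  ⁻¹-nonNeg {x} 0<x = certify
    (solve 2 (λ a b → b :- con (+ 0) := a :* (b :* b) :+ (:- b) :* (a :* b :- con (+ 1))) refl x (x ⁻¹))
    (proj₁ 0<x ⊗ x*x-nonNeg (x ⁻¹) ⊕ *-null (- (x ⁻¹)) (*-inverse 0<x))

  *-cancelˡ-≤ : ∀ {c x y} → 0# < c → c * x ≤ c * y → x ≤ y
  *-cancelˡ-≤ {c} {x} {y} 0<c cx≤cy = certify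
    (solve 4 (λ c c⁻¹ x y → y :- x :=
       c⁻¹ :* (c :* y :- c :* x) :+ (x :- y) :* (c :* c⁻¹ :- con (+ 1))) refl c (c ⁻¹) x y)
    (⁻¹-nonNeg 0<c ⊗ sub-nonNeg cx≤cy ⊕ *-null (x - y) (*-inverse 0<c))

  *-pos : ∀ {x y} → 0# < x → 0# < y → 0# < x * y
  *-pos {x} {y} 0<x 0<y = (proj₁ 0<x ⊗ proj₁ 0<y) , λ 0≈xy → <⇒≱ 0<y (*-cancelˡ-≤ 0<x
    (certify (solve 2 (λ x y → x :* con (+ 0) :- x :* y := con (+ 1) :* (con (+ 0) :- x :* y)) refl x y)
             (*-null 1# 0≈xy)))

  /-* : ∀ x {y} → 0# < y → y * (x / y) ≈ x
  /-* x {y} 0<y = trans (solve 3 (λ y x i → y :* (x :* i) := x :* (y :* i)) refl y x (y ⁻¹))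
    (trans (*-congˡ (*-inverse 0<y)) (*-identityʳ x))

  /-nonNeg : ∀ {x y} → 0# ≤ x → 0# < y → 0# ≤ x / y
  /-nonNeg 0≤x 0<y = 0≤x ⊗ ⁻¹-nonNeg 0<y

  -- If `y < x`, then `x + y` is positive and can be cancelled from `(x + y) * (y - x)`, the
  -- factorisation of `y * y - x * x`.
  square-cancel-≤ : ∀ {x y} → 0# ≤ y → x * x ≤ y * y → x ≤ y
  square-cancel-≤ {x} {y} 0≤y x²≤y² with x ≤? y
  ... | yes x≤y = x≤y
  ... | no  x≰y = *-cancelˡ-≤ 0<x+y
    (certify (solve 2 (λ x y → (x :+ y) :* y :- (x :+ y) :* x := y :* y :- x :* x) refl x y)
             (sub-nonNeg x²≤y²))
    where
    0<x+y : 0# < x + y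
    0<x+y = <-≤-trans (≤-trans 0≤y (proj₁ y<x) , λ 0≈x → <⇒≱ y<x (≤-trans (≤-reflexive (sym 0≈x)) 0≤y))
              (certify (solve 2 (λ x y → x :+ y :- x := y) refl x y) 0≤y)
      where
      y<x = ≰⇒> x≰y

  -- Square roots from least upper bounds.

  private
    √-isLub : ∀ a → IsLub (SqBelow a) (√ a)
    √-isLub a = proj₂ (√-lub a)

  √-nonNeg : ∀ a → 0# ≤ √ a
  √-nonNeg a = proj₁ (√-isLub a) 0# (proj₂ (sqBelow-inhabited a))

  -- If s = √ a had s² > a, then the Newton step (s² + a)/2s would be a smaller upper bound.
  √-square-≤ : ∀ {a} → 0# ≤ a → √ a * √ a ≤ a
  √-square-≤ {a} 0≤a with √ a * √ a ≤? a
  ... | yes s²≤a = s²≤a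
  ... | no  s²≰a = ⊥-elim (<⇒≱ a<s² (certify
          (solve 4 (λ s a c h → a :- s :* s :=
             (c :* ((s :- h) :- s)) :+ con (+ 1) :* (c :* h :- (s :* s :- a)))
             refl s a 2s h)
          (proj₁ 0<2s ⊗ sub-nonNeg s≤s-h ⊕ *-null 1# 2s*h≈)))
    where
    s = √ a
    2s = s + s
    a<s² = ≰⇒> s²≰a
    h = (s * s - a) / 2s

    0<s : 0# < s
    0<s = √-nonNeg a , λ 0≈s → <⇒≱ a<s² (certify
      (solve 2 (λ s a → a :- s :* s := a :+ s :* (con (+ 0) :- s)) refl s a)
      (0≤a ⊕ *-null s 0≈s))

    0<2s : 0# < 2s
    0<2s = <-≤-trans 0<s (certify (solve 1 (λ s → s :+ s :- s := s) refl s) (proj₁ 0<s))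

    2s*h≈ : 2s * h ≈ s * s - a
    2s*h≈ = /-* (s * s - a) 0<2s

    0≤s-h : 0# ≤ s - h
    0≤s-h = *-cancelˡ-≤ 0<2s (certify
      (solve 3 (λ s a h → (s :+ s) :* (s :- h) :- (s :+ s) :* con (+ 0) :=
         (s :* s :+ a) :+ (:- con (+ 1)) :* ((s :+ s) :* h :- (s :* s :- a))) refl s a h)
      (x*x-nonNeg s ⊕ 0≤a ⊕ *-null (- 1#) 2s*h≈))

    s≤s-h : s ≤ s - h
    s≤s-h = proj₂ (√-isLub a) (s - h) (λ x x²≤ → square-cancel-≤ 0≤s-h (≤-trans x²≤ bound))
      where
      0⊔a≤a : 0# ⊔ a ≤ a
      0⊔a≤a = ⊔-lub 0≤a ≤-refl
      bound : 0# ⊔ a ≤ (s - h) * (s - h)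
      bound = ≤-trans 0⊔a≤a (certify
        (solve 3 (λ s a h → (s :- h) :* (s :- h) :- a :=
           h :* h :+ (:- con (+ 1)) :* ((s :+ s) :* h :- (s :* s :- a))) refl s a h)
        (x*x-nonNeg h ⊕ *-null (- 1#) 2s*h≈))

  -- If s = √ a had s² < a, then s + h with h = (a − s²)/(2s + 1 + (a − s²)) ≤ 1 would
  -- still have square at most a.
  √-square-≥ : ∀ {a} → 0# ≤ a → a ≤ √ a * √ a
  √-square-≥ {a} 0≤a with a ≤? √ a * √ a
  ... | yes a≤s² = a≤s²
  ... | no  a≰s² = ⊥-elim (<⇒≱ 0<δ (certify
          (solve 4 (λ s h c δ → con (+ 0) :- δ :=
             c :* (s :- (s :+ h)) :+ con (+ 1) :* (c :* h :- δ)) refl s h c δ)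
          (proj₁ 0<c ⊗ sub-nonNeg s+h≤s ⊕ *-null 1# ch≈δ)))
    where
    s = √ a
    δ = a - s * s
    c = s + s + 1# + δ
    h = δ / c
    0≤s = √-nonNeg a
    0<δ = sub-pos (≰⇒> a≰s²)

    0<c : 0# < c
    0<c = <-≤-trans 0<1 (certify
      (solve 2 (λ s δ → s :+ s :+ con (+ 1) :+ δ :- con (+ 1) := s :+ s :+ δ) refl s δ)
      (0≤s ⊕ 0≤s ⊕ proj₁ 0<δ))

    ch≈δ : c * h ≈ δ
    ch≈δ = /-* δ 0<c

    0≤h : 0# ≤ h
    0≤h = /-nonNeg (proj₁ 0<δ) 0<c

    h≤1 : h ≤ 1#
    h≤1 = *-cancelˡ-≤ 0<c (certify
      (solve 3 (λ s h δ → (s :+ s :+ con (+ 1) :+ δ) :* con (+ 1) :- (s :+ s :+ con (+ 1) :+ δ) :* h :=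
         s :+ s :+ con (+ 1) :+ (:- con (+ 1)) :* ((s :+ s :+ con (+ 1) :+ δ) :* h :- δ)) refl s h δ)
      (0≤s ⊕ 0≤s ⊕ 1-nonNeg ⊕ *-null (- 1#) ch≈δ))

    s+h≤s : s + h ≤ s
    s+h≤s = proj₁ (√-isLub a) (s + h) (≤-trans (certify
      (solve 3 (λ s h a → a :- (s :+ h) :* (s :+ h) :=
         h :* (con (+ 1) :- h) :+ (a :- s :* s) :* h :+
         (:- con (+ 1)) :* ((s :+ s :+ con (+ 1) :+ (a :- s :* s)) :* h :- (a :- s :* s))) refl s h a)
      (0≤h ⊗ sub-nonNeg h≤1 ⊕ proj₁ 0<δ ⊗ 0≤h ⊕ *-null (- 1#) ch≈δ))
      (x≤y⊔x 0# a))

  √-square : ∀ {a} → 0# ≤ a → √ a * √ a ≈ a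
  √-square 0≤a = ≤-antisym (√-square-≤ 0≤a) (√-square-≥ 0≤a)

  √-mono-≤ : ∀ {a b} → 0# ≤ a → a ≤ b → √ a ≤ √ b
  √-mono-≤ {a} {b} 0≤a a≤b = square-cancel-≤ (√-nonNeg b)
    (≤-trans (√-square-≤ 0≤a) (≤-trans a≤b (√-square-≥ (≤-trans 0≤a a≤b))))

  √-* : ∀ {a b} → 0# ≤ a → 0# ≤ b → √ (a * b) ≈ √ a * √ b
  √-* {a} {b} 0≤a 0≤b = ≤-antisym
    (square-cancel-≤ (√-nonNeg a ⊗ √-nonNeg b)
      (≤-reflexive (trans (√-square (0≤a ⊗ 0≤b)) (sym squares))))
    (square-cancel-≤ (√-nonNeg (a * b))
      (≤-reflexive (trans squares (sym (√-square (0≤a ⊗ 0≤b))))))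
    where
    squares : (√ a * √ b) * (√ a * √ b) ≈ a * b
    squares = trans
      (solve 2 (λ p q → (p :* q) :* (p :* q) := (p :* p) :* (q :* q)) refl (√ a) (√ b))
      (*-cong (√-square 0≤a) (√-square 0≤b))

  √-cong : ∀ {a b} → 0# ≤ a → a ≈ b → √ a ≈ √ b
  √-cong 0≤a a≈b = ≤-antisym (√-mono-≤ 0≤a (≤-reflexive a≈b))
    (√-mono-≤ (≤-trans 0≤a (≤-reflexive a≈b)) (≤-reflexive (sym a≈b)))

-- Finite sums and inner products.

module EuclideanGeometry (R : Reals) where
  open Reals R
  open Euclidean R
  open OrderedField R
  open SemiringSum semiring public
    using (sum-cong-≋; ∑-distrib-+; ∑-comm; *-distribˡ-sum; *-distribʳ-sum)

  sum-mono-≤ : ∀ {n} {f g : Fin n → ℝ} → (∀ i → f i ≤ g i) → sum f ≤ sum g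
  sum-mono-≤ {zero}          f≤g = ≤-refl
  sum-mono-≤ {suc n} {f} {g} f≤g = certify
    (solve 4 (λ a b s t → b :+ t :- (a :+ s) := (b :- a) :+ (t :- s)) refl (f zero) (g zero) _ _)
    (sub-nonNeg (f≤g zero) ⊕ sub-nonNeg (sum-mono-≤ (λ i → f≤g (suc i))))

  sum-const : ∀ n a → sum {n} (λ _ → a) ≈ fromℕ n * a
  sum-const zero    a = sym (zeroˡ a)
  sum-const (suc n) a = trans (+-congˡ (sum-const n a))
    (solve 2 (λ a m → a :+ m :* a := (con (+ 1) :+ m) :* a) refl a (fromℕ n))

  sum-nonNeg : ∀ {n} {f : Fin n → ℝ} → (∀ i → 0# ≤ f i) → 0# ≤ sum f
  sum-nonNeg {zero}  0≤f = ≤-refl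
  sum-nonNeg {suc n} 0≤f = 0≤f zero ⊕ sum-nonNeg (λ i → 0≤f (suc i))

  sum-- : ∀ {n} (f g : Fin n → ℝ) → sum (λ i → f i - g i) ≈ sum f - sum g
  sum-- f g = trans
    (solve 2 (λ s t → s := s :+ t :- t) refl (sum (λ i → f i - g i)) (sum g))
    (+-congʳ (trans (sym (∑-distrib-+ (λ i → f i - g i) g))
      (sum-cong-≋ (λ i → solve 2 (λ a b → a :- b :+ b := a) refl (f i) (g i)))))

  module _ {d : ℕ} where

    ∙-cong : {u u′ v v′ : ℝ^ d} → u ≋ u′ → v ≋ v′ → u ∙ v ≈ u′ ∙ v′
    ∙-cong u≋u′ v≋v′ = sum-cong-≋ (λ j → *-cong (u≋u′ j) (v≋v′ j))

    ∙-comm : (u v : ℝ^ d) → u ∙ v ≈ v ∙ u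
    ∙-comm u v = sum-cong-≋ (λ j → *-comm (u j) (v j))

    ∙-⊟ˡ : (u v w : ℝ^ d) → (u ⊟ v) ∙ w ≈ u ∙ w - v ∙ w
    ∙-⊟ˡ u v w = trans
      (sum-cong-≋ (λ j → solve 3 (λ a b c → (a :- b) :* c := a :* c :- b :* c) refl (u j) (v j) (w j)))
      (sum-- (λ j → u j * w j) (λ j → v j * w j))

    ∙-⊛ˡ : ∀ a (u v : ℝ^ d) → (a ⊛ u) ∙ v ≈ a * (u ∙ v)
    ∙-⊛ˡ a u v = trans
      (sum-cong-≋ (λ j → solve 3 (λ a b c → (a :* b) :* c := a :* (b :* c)) refl a (u j) (v j)))
      (sym (*-distribˡ-sum a (λ j → u j * v j)))

    ∙-⊟ʳ : (u v w : ℝ^ d) → u ∙ (v ⊟ w) ≈ u ∙ v - u ∙ w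
    ∙-⊟ʳ u v w = trans (∙-comm u (v ⊟ w)) (trans (∙-⊟ˡ v w u)
      (+-cong (∙-comm v u) (-‿cong (∙-comm w u))))

    ∙-⊛ʳ : ∀ a (u v : ℝ^ d) → u ∙ (a ⊛ v) ≈ a * (u ∙ v)
    ∙-⊛ʳ a u v = trans (∙-comm u (a ⊛ v)) (trans (∙-⊛ˡ a v u) (*-congˡ (∙-comm v u)))

    ∙-vsumˡ : ∀ {n} (v : Fin n → ℝ^ d) (w : ℝ^ d) → vsum v ∙ w ≈ sum (λ i → v i ∙ w)
    ∙-vsumˡ v w = trans
      (sum-cong-≋ (λ j → *-distribʳ-sum (w j) (λ i → v i j)))
      (∑-comm (λ j i → v i j * w j))

    ∙-vsumʳ : ∀ {n} (w : ℝ^ d) (v : Fin n → ℝ^ d) → w ∙ vsum v ≈ sum (λ i → w ∙ v i)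
    ∙-vsumʳ w v = trans (∙-comm w (vsum v)) (trans (∙-vsumˡ v w) (sum-cong-≋ (λ i → ∙-comm (v i) w)))

    ∙-zeroˡ : (v : ℝ^ d) → 𝟎 ∙ v ≈ 0#
    ∙-zeroˡ v = trans (sum-cong-≋ (λ j → solve 1 (λ a → con (+ 0) :* a := con (+ 0) :* con (+ 0)) refl (v j)))
      (trans (sym (*-distribˡ-sum 0# (λ (_ : Fin d) → 0#))) (zeroˡ _))

    ∙-self-nonNeg : (v : ℝ^ d) → 0# ≤ v ∙ v
    ∙-self-nonNeg v = sum-nonNeg (λ j → x*x-nonNeg (v j))

    ‖‖-square : (v : ℝ^ d) → ‖ v ‖ * ‖ v ‖ ≈ v ∙ v
    ‖‖-square v = √-square (∙-self-nonNeg v)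

    ∙-self-⊟ : (u v : ℝ^ d) → (u ⊟ v) ∙ (u ⊟ v) ≈ u ∙ u - fromℕ 2 * (u ∙ v) + v ∙ v
    ∙-self-⊟ u v = trans (∙-⊟ˡ u v (u ⊟ v)) (trans
      (+-cong (∙-⊟ʳ u u v) (-‿cong (trans (∙-⊟ʳ v u v) (+-congʳ (∙-comm v u)))))
      (solve 3 (λ uu uv vv → uu :- uv :- (uv :- vv) := uu :- con (+ 2) :* uv :+ vv) refl
        (u ∙ u) (u ∙ v) (v ∙ v)))

    ∙-self-⊛ : ∀ a (v : ℝ^ d) → (a ⊛ v) ∙ (a ⊛ v) ≈ a * a * (v ∙ v)
    ∙-self-⊛ a v = trans (∙-⊛ˡ a v (a ⊛ v)) (trans (*-congˡ (∙-⊛ʳ a v v))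
      (solve 2 (λ a b → a :* (a :* b) := a :* a :* b) refl a (v ∙ v)))

    ∙-self-⊟⊛ : ∀ (u : ℝ^ d) a v → (u ⊟ (a ⊛ v)) ∙ (u ⊟ (a ⊛ v))
                  ≈ u ∙ u - fromℕ 2 * (a * (u ∙ v)) + a * a * (v ∙ v)
    ∙-self-⊟⊛ u a v = trans (∙-self-⊟ u (a ⊛ v))
      (+-cong (+-congˡ (-‿cong (*-congˡ (∙-⊛ʳ a u v)))) (∙-self-⊛ a v))

    -- By the parallelogram law the difference of the two sides is the squared norm of `u + v`,
    -- written here as `u ⊟ ((- 1#) ⊛ v)`.
    ∙-self-⊟-≤ : (u v : ℝ^ d) → (u ⊟ v) ∙ (u ⊟ v) ≤ fromℕ 2 * (u ∙ u + v ∙ v)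
    ∙-self-⊟-≤ u v = certify
      (trans (+-congˡ (-‿cong (∙-self-⊟ u v))) (trans
        (solve 3 (λ uu uv vv → con (+ 2) :* (uu :+ vv) :- (uu :- con (+ 2) :* uv :+ vv) :=
           uu :- con (+ 2) :* ((:- con (+ 1)) :* uv) :+ (:- con (+ 1)) :* (:- con (+ 1)) :* vv) refl
           (u ∙ u) (u ∙ v) (v ∙ v))
        (sym (∙-self-⊟⊛ u (- 1#) v))))
      (∙-self-nonNeg (u ⊟ ((- 1#) ⊛ v)))

    -- Cauchy-Schwarz with bounds in place of norms: expand the squared norm of `(b ⊛ u) ⊟ (a ⊛ v)`,
    -- which is nonnegative, and cancel `2ab`.
    ∙-≤ : ∀ {a b} (u v : ℝ^ d) → 0# < a → 0# < b → u ∙ u ≤ a * a → v ∙ v ≤ b * b → u ∙ v ≤ a * b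
    ∙-≤ {a} {b} u v 0<a 0<b u²≤a² v²≤b² = *-cancelˡ-≤ (*-pos 0<2 (*-pos 0<a 0<b)) (certify
      (trans (solve 5 (λ a b uu uv vv → con (+ 2) :* (a :* b) :* (a :* b) :- con (+ 2) :* (a :* b) :* uv :=
               b :* b :* (a :* a :- uu) :+ a :* a :* (b :* b :- vv) :+
               (b :* b :* uu :- con (+ 2) :* (a :* (b :* uv)) :+ a :* a :* vv))
               refl a b (u ∙ u) (u ∙ v) (v ∙ v))
             (+-congˡ (sym (trans (∙-self-⊟⊛ (b ⊛ u) a v)
               (+-congʳ (+-cong (∙-self-⊛ b u) (-‿cong (*-congˡ (*-congˡ (∙-⊛ˡ b u v))))))))))
      (x*x-nonNeg b ⊗ sub-nonNeg u²≤a² ⊕ x*x-nonNeg a ⊗ sub-nonNeg v²≤b²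
        ⊕ ∙-self-nonNeg ((b ⊛ u) ⊟ (a ⊛ v))))

    -- Convexity of balls and projection onto convex sets.

    segment : ℝ^ d → ℝ^ d → ℝ → ℝ^ d
    segment u v s = u ⊟ (s ⊛ (u ⊟ v))

    Convex : Pred (ℝ^ d) 0ℓ → Set
    Convex K = ∀ {u v s} → K u → K v → 0# ≤ s → s ≤ 1# → K (segment u v s)

    Ball⇒∙-≤ : ∀ {r v} → Ball r v → v ∙ v ≤ r * r
    Ball⇒∙-≤ {r} {v} ‖v‖≤r = ≤-trans (≤-reflexive (sym (‖‖-square v))) (certify
      (solve 2 (λ r n → r :* r :- n :* n := (r :+ n) :* (r :- n)) refl r ‖ v ‖)
      ((≤-trans (√-nonNeg _) ‖v‖≤r ⊕ √-nonNeg _) ⊗ sub-nonNeg ‖v‖≤r))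

    ∙-≤⇒Ball : ∀ {r v} → 0# ≤ r → v ∙ v ≤ r * r → Ball r v
    ∙-≤⇒Ball {r} {v} 0≤r v²≤r² = square-cancel-≤ 0≤r (≤-trans (≤-reflexive (‖‖-square v)) v²≤r²)

    -- Rests on the identity `‖u − s(u − v)‖² = (1 − s)‖u‖² + s‖v‖² − s(1 − s)‖u − v‖²`.
    Ball-convex : ∀ {r} → Convex (Ball r)
    Ball-convex {r} {u} {v} {s} u∈ v∈ 0≤s s≤1 =
      ∙-≤⇒Ball (≤-trans (√-nonNeg _) u∈) (certify
        (trans (+-congˡ (-‿cong (trans (∙-self-⊟⊛ u s (u ⊟ v))
                  (+-cong (+-congˡ (-‿cong (*-congˡ (*-congˡ (∙-⊟ʳ u u v))))) (*-congˡ (∙-self-⊟ u v))))))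
          (trans (solve 5 (λ r s uu uv vv →
              r :* r :- (uu :- con (+ 2) :* (s :* (uu :- uv)) :+ s :* s :* (uu :- con (+ 2) :* uv :+ vv)) :=
              (con (+ 1) :- s) :* (r :* r :- uu) :+ s :* (r :* r :- vv)
              :+ s :* (con (+ 1) :- s) :* (uu :- con (+ 2) :* uv :+ vv)) refl r s (u ∙ u) (u ∙ v) (v ∙ v))
            (+-congˡ (*-congˡ (sym (∙-self-⊟ u v))))))
        (sub-nonNeg s≤1 ⊗ sub-nonNeg (Ball⇒∙-≤ u∈) ⊕ 0≤s ⊗ sub-nonNeg (Ball⇒∙-≤ v∈)
          ⊕ 0≤s ⊗ sub-nonNeg s≤1 ⊗ ∙-self-nonNeg (u ⊟ v)))

    -- The variational inequality of a projection, by contradiction: a negative inner product would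
    -- let a move along the segment towards `u` reach a point of `K` closer to `α` than `p`.
    projection-obtuse : ∀ {K α p u} → Convex K → IsProjection K α p → K u →
                        0# ≤ (α ⊟ p) ∙ (p ⊟ u)
    projection-obtuse {K} {α} {p} {u} convex (p∈ , minimal) u∈ with 0# ≤? (α ⊟ p) ∙ (p ⊟ u)
    ... | yes 0≤k = 0≤k
    ... | no  0≰k = ⊥-elim (<⇒≱ 0<c (certify
            (solve 3 (λ b k s → con (+ 0) :- (con (+ 0) :- k) :=
               (con (+ 2) :* k :+ s :* b) :+ s :* (con (+ 0) :- k) :+
               (:- con (+ 1)) :* ((con (+ 0) :- k :+ b) :* s :- (con (+ 0) :- k))) refl b k s)
            (slope-nonNeg ⊕ 0≤s ⊗ proj₁ 0<c ⊕ *-null (- 1#) ms≈c)))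
      where
      e = α ⊟ p
      w = p ⊟ u
      k = e ∙ w
      b = w ∙ w
      c = 0# - k
      m = c + b
      -- Moving from p towards u by s = c/(c + b) decreases the squared distance to α by at
      -- least s c.
      s = c / m
      0<c = sub-pos (≰⇒> 0≰k)

      0<m : 0# < m
      0<m = <-≤-trans 0<c (certify (solve 2 (λ c b → c :+ b :- c := b) refl c b) (∙-self-nonNeg w))

      ms≈c : m * s ≈ c
      ms≈c = /-* c 0<m

      0≤s : 0# ≤ s
      0≤s = /-nonNeg (proj₁ 0<c) 0<m

      s≤1 : s ≤ 1#
      s≤1 = *-cancelˡ-≤ 0<m (certify
        (solve 3 (λ c b s → (c :+ b) :* con (+ 1) :- (c :+ b) :* s :=
           b :+ (:- con (+ 1)) :* ((c :+ b) :* s :- c)) refl c b s)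
        (∙-self-nonNeg w ⊕ *-null (- 1#) ms≈c))

      q = segment p u s

      closest : e ∙ e ≤ (α ⊟ q) ∙ (α ⊟ q)
      closest = ≤-trans (Ball⇒∙-≤ (minimal q (convex p∈ u∈ 0≤s s≤1)))
                        (≤-reflexive (‖‖-square (α ⊟ q)))

      expansion : (α ⊟ q) ∙ (α ⊟ q) ≈ e ∙ e - fromℕ 2 * ((- s) * k) + (- s) * (- s) * b
      expansion = trans (∙-cong shift shift) (∙-self-⊟⊛ e (- s) w)
        where
        shift : (α ⊟ q) ≋ (e ⊟ ((- s) ⊛ w))
        shift j = solve 4 (λ α p u s →
          α :- (p :- s :* (p :- u)) := (α :- p) :- (:- s) :* (p :- u)) refl (α j) (p j) (u j) s

      -- Passing from `p` to `q` changes the squared distance by `s (2k + s b)`. Multiplied by `m`,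
      -- this becomes `c (2k + s b)` because `m s = c`, so `c`, already known to be positive, is
      -- what gets cancelled.
      slope-nonNeg : 0# ≤ fromℕ 2 * k + s * b
      slope-nonNeg = *-cancelˡ-≤ 0<c (certify
        (trans (solve 4 (λ b k s ee → (con (+ 0) :- k) :* (con (+ 2) :* k :+ s :* b) :- (con (+ 0) :- k) :* con (+ 0) :=
           (con (+ 0) :- k :+ b) :* ((ee :- con (+ 2) :* ((:- s) :* k) :+ (:- s) :* (:- s) :* b) :- ee)
           :+ (:- (con (+ 2) :* k :+ s :* b)) :* ((con (+ 0) :- k :+ b) :* s :- (con (+ 0) :- k))) refl b k s (e ∙ e))
          (+-congʳ (*-congˡ (+-congʳ (sym expansion)))))
        (proj₁ 0<m ⊗ sub-nonNeg closest ⊕ *-null (- (fromℕ 2 * k + s * b)) ms≈c))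

    -- With `α − u = e + w`, the squared norm of `e + w` exceeds that of `w` by `‖e‖² + 2 e ∙ w`,
    -- and `e ∙ w` is nonnegative by `projection-obtuse`.
    projection-nonexpansive : ∀ {K α p u} → Convex K → IsProjection K α p → K u →
                              (p ⊟ u) ∙ (p ⊟ u) ≤ (α ⊟ u) ∙ (α ⊟ u)
    projection-nonexpansive {K} {α} {p} {u} convex proj u∈ = certify
      (trans (+-congʳ (trans (∙-cong shift shift) (∙-self-⊟⊛ e (- 1#) w)))
        (solve 3 (λ ee ew ww →
           ee :- con (+ 2) :* ((:- con (+ 1)) :* ew) :+ (:- con (+ 1)) :* (:- con (+ 1)) :* ww :- ww :=
           ee :+ (ew :+ ew)) refl (e ∙ e) (e ∙ w) (w ∙ w)))
      (∙-self-nonNeg e ⊕ (obtuse ⊕ obtuse))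
      where
      e = α ⊟ p
      w = p ⊟ u
      obtuse = projection-obtuse convex proj u∈
      shift : (α ⊟ u) ≋ (e ⊟ ((- 1#) ⊛ w))
      shift j = solve 3 (λ α p u → α :- u := (α :- p) :- (:- con (+ 1)) :* (p :- u)) refl (α j) (p j) (u j)

-- Projected subgradient descent on the regularised hinge loss.

module ProjectedSVM (R : Reals) where
  open Reals R
  open Euclidean R
  open SVM R
  open OrderedField R
  open EuclideanGeometry R

  sum-telescope : ∀ n (f Φ : ℕ → ℝ) → (∀ t → f t ≤ Φ (suc t) - Φ t) →
                  sum {n} (λ t → f (toℕ t)) ≤ Φ n - Φ 0
  sum-telescope zero    f Φ f≤ΔΦ = ≤-reflexive (sym (-‿inverseʳ (Φ 0)))
  sum-telescope (suc n) f Φ f≤ΔΦ = certify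
    (solve 5 (λ a b c f s → a :- c :- (f :+ s) := (b :- c :- f) :+ (a :- b :- s)) refl
      (Φ (suc n)) (Φ 1) (Φ 0) (f 0) (sum {n} (λ t → f (suc (toℕ t)))))
    (sub-nonNeg (f≤ΔΦ 0)
      ⊕ sub-nonNeg (sum-telescope n (λ t → f (suc t)) (λ t → Φ (suc t)) (λ t → f≤ΔΦ (suc t))))

  Bounded : ℝ → Set
  Bounded a = (- 1# ≤ a) × (a ≤ 1#)

  Bounded-square : ∀ {a} → Bounded a → a * a ≤ 1#
  Bounded-square {a} (-1≤a , a≤1) = certify
    (solve 1 (λ a → con (+ 1) :- a :* a := (con (+ 1) :- a) :* (a :- (:- con (+ 1)))) refl a)
    (sub-nonNeg a≤1 ⊗ sub-nonNeg -1≤a)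

  mean-Bounded : ∀ n → .{{NonZero n}} → {f : Fin n → ℝ} → (∀ i → Bounded (f i)) →
                 Bounded (1# / fromℕ n * sum f)
  mean-Bounded n {f} bounded =
      *-cancelˡ-≤ 0<n (certify
        (solve 3 (λ n c s → n :* (c :* s) :- n :* (:- con (+ 1)) :=
           (s :- n :* (:- con (+ 1))) :+ s :* (n :* c :- con (+ 1))) refl n′ c s)
        (sub-nonNeg (≤-trans (≤-reflexive (sym (sum-const n (- 1#)))) (sum-mono-≤ (λ i → proj₁ (bounded i))))
          ⊕ *-null s (/-* 1# 0<n)))
    , *-cancelˡ-≤ 0<n (certify
        (solve 3 (λ n c s → n :* con (+ 1) :- n :* (c :* s) :=
           (n :* con (+ 1) :- s) :+ (:- s) :* (n :* c :- con (+ 1))) refl n′ c s)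
        (sub-nonNeg (≤-trans (sum-mono-≤ (λ i → proj₂ (bounded i))) (≤-reflexive (sum-const n 1#)))
          ⊕ *-null (- s) (/-* 1# 0<n)))
    where
    n′ = fromℕ n
    c = 1# / n′
    s = sum f
    0<n : 0# < n′
    0<n = <-≤-trans 0<1 (1≤fromℕ n)

  module _ {N d : ℕ} .{{_ : NonZero N}} .{{_ : NonZero d}}
    (x : Fin N → ℝ^ d) (x-bounded : ∀ i j → Bounded (x i j))
    (y : Fin N → ℝ) (y-label : ∀ i → (y i ≈ - 1#) ⊎ (y i ≈ 1#))
    (lam : ℝ) (0<lam : 0# < lam) where

    private
      f = F x y lam
      ∇f = ∇F x y lam
      K = 𝒦 x y lam
      1/N = 1# / fromℕ N
      √d = √ (fromℕ d)
      2lam = fromℕ 2 * lam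
      r = √d / 2lam
      D² = fromℕ 4 * (r * r)

      0<N : 0# < fromℕ N
      0<N = <-≤-trans 0<1 (1≤fromℕ N)

      0≤lam : 0# ≤ lam
      0≤lam = proj₁ 0<lam

      0<2lam : 0# < 2lam
      0<2lam = *-pos 0<2 0<lam

      √d²≈d : √d * √d ≈ fromℕ d
      √d²≈d = √-square (fromℕ-nonNeg d)

      1≤√ : ∀ n → .{{NonZero n}} → 1# ≤ √ (fromℕ n)
      1≤√ n = square-cancel-≤ (√-nonNeg _)
        (≤-trans (≤-reflexive (*-identityˡ 1#)) (≤-trans (1≤fromℕ n) (√-square-≥ (fromℕ-nonNeg n))))

      0<√d : 0# < √d
      0<√d = <-≤-trans 0<1 (1≤√ d)

      0≤r : 0# ≤ r
      0≤r = /-nonNeg (√-nonNeg _) 0<2lam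

      2lam*r≈√d : 2lam * r ≈ √d
      2lam*r≈√d = /-* √d 0<2lam

    -- The subgradient inequality and gradient bounds.

    margin : ℝ^ d → Fin N → ℝ
    margin β i = y i * (β ∙ x i)

    hinge : ℝ^ d → Fin N → ℝ
    hinge β i = 0# ⊔ (1# - margin β i)

    -- Repeats the summand of `∇F`, so that `∇f β` is definitionally `(2lam ⊛ β) ⊟ pull β`.
    active : ℝ^ d → Fin N → ℝ^ d
    active β i = if does (margin β i ≤? 1#) then y i ⊛ x i else 𝟎

    pull : ℝ^ d → ℝ^ d
    pull β = 1/N ⊛ vsum (active β)

    -- The hinge at `v` lies above both of its affine pieces, `0` and `1 − margin`. Each branch uses
    -- the piece that is attained at `β`; at the kink both are, and the second is chosen.
    hinge-subgradient : ∀ β v i → hinge β i - active β i ∙ (v ⊟ β) ≤ hinge v i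
    hinge-subgradient β v i with margin β i ≤? 1#
    ... | yes m≤1 = certify
      (solve 6 (λ hv hβ y bx vx z → hv :- (hβ :- z) :=
         (hv :- (con (+ 1) :- y :* vx)) :+ ((con (+ 1) :- y :* bx) :- hβ)
         :+ con (+ 1) :* (z :- y :* (vx :- bx))) refl
         (hinge v i) (hinge β i) (y i) (β ∙ x i) (v ∙ x i) ((y i ⊛ x i) ∙ (v ⊟ β)))
      (sub-nonNeg (x≤y⊔x 0# _) ⊕ sub-nonNeg (⊔-lub (sub-nonNeg m≤1) ≤-refl)
        ⊕ *-null 1# (trans (∙-⊛ˡ (y i) (x i) (v ⊟ β))
            (*-congˡ (trans (∙-comm (x i) (v ⊟ β)) (∙-⊟ˡ v β (x i))))))
    ... | no m≰1 = certify
      (solve 3 (λ hv hβ z → hv :- (hβ :- z) := hv :+ (con (+ 0) :- hβ) :+ con (+ 1) :* (z :- con (+ 0)))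
         refl (hinge v i) (hinge β i) (𝟎 ∙ (v ⊟ β)))
      (x≤x⊔y 0# _ ⊕ sub-nonNeg (⊔-lub ≤-refl (certify
          (solve 1 (λ m → con (+ 0) :- (con (+ 1) :- m) := m :- con (+ 1)) refl (margin β i))
          (sub-nonNeg (proj₁ (≰⇒> m≰1)))))
        ⊕ *-null 1# (∙-zeroˡ (v ⊟ β)))

    ∇F-∙ : ∀ β w → ∇f β ∙ w ≈ 2lam * (β ∙ w) - pull β ∙ w
    ∇F-∙ β w = trans (∙-⊟ˡ (2lam ⊛ β) (pull β) w) (+-congʳ (∙-⊛ˡ 2lam β w))

    -- The hinge part is the mean of the inequalities `hinge-subgradient`. The regulariser
    -- contributes no error, as `‖v‖² = ‖β‖² + 2 β ∙ (v − β) + ‖v − β‖²` exactly.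
    F-subgradient : ∀ β v → f β + ∇f β ∙ (v ⊟ β) + lam * ((v ⊟ β) ∙ (v ⊟ β)) ≤ f v
    F-subgradient β v = certify
      (solve 12 (λ c l hv hβ z nv nβ vv ββ βv g ww →
         c :* hv :+ l :* nv :- (c :* hβ :+ l :* nβ :+ g :+ l :* ww) :=
         c :* (hv :- (hβ :- z)) :+ l :* (nv :- vv) :+ (:- l) :* (nβ :- ββ)
         :+ (:- con (+ 1)) :* (g :- (con (+ 2) :* l :* (βv :- ββ) :- c :* z))
         :+ (:- l) :* (ww :- (vv :- con (+ 2) :* βv :+ ββ))) refl
         1/N lam (sum (hinge v)) (sum (hinge β)) Z (‖ v ‖ * ‖ v ‖) (‖ β ‖ * ‖ β ‖)
         (v ∙ v) (β ∙ β) (β ∙ v) (∇f β ∙ w) (w ∙ w))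
      (/-nonNeg 1-nonNeg 0<N ⊗ sub-nonNeg hinges ⊕ *-null lam (‖‖-square v) ⊕ *-null (- lam) (‖‖-square β)
        ⊕ *-null (- 1#) (trans (∇F-∙ β w) (+-cong (*-congˡ (∙-⊟ʳ β v β))
            (-‿cong (trans (∙-⊛ˡ 1/N (vsum (active β)) w) (*-congˡ (∙-vsumˡ (active β) w))))))
        ⊕ *-null (- lam) (trans (∙-self-⊟ v β) (+-congʳ (+-congˡ (-‿cong (*-congˡ (∙-comm v β)))))))
      where
      w = v ⊟ β
      Z = sum (λ i → active β i ∙ w)
      hinges : sum (hinge β) - Z ≤ sum (hinge v)
      hinges = ≤-trans (≤-reflexive (sym (sum-- (hinge β) (λ i → active β i ∙ w))))
                       (sum-mono-≤ (hinge-subgradient β v))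

    active-Bounded : ∀ β i j → Bounded (active β i j)
    active-Bounded β i j with does (margin β i ≤? 1#)
    ... | false =
        certify (solve 0 (con (+ 0) :- (:- con (+ 1)) := con (+ 1)) refl) 1-nonNeg , 1-nonNeg
    ... | true with y-label i
    ...   | inj₁ y≈-1 =
        certify (solve 2 (λ y x → y :* x :- (:- con (+ 1)) :=
                   (con (+ 1) :- x) :+ x :* (y :- (:- con (+ 1)))) refl (y i) (x i j))
                (sub-nonNeg (proj₂ (x-bounded i j)) ⊕ *-null (x i j) y≈-1)
      , certify (solve 2 (λ y x → con (+ 1) :- y :* x :=
                   (x :- (:- con (+ 1))) :+ (:- x) :* (y :- (:- con (+ 1)))) refl (y i) (x i j))
                (sub-nonNeg (proj₁ (x-bounded i j)) ⊕ *-null (- x i j) y≈-1)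
    ...   | inj₂ y≈1 =
        certify (solve 2 (λ y x → y :* x :- (:- con (+ 1)) :=
                   (x :- (:- con (+ 1))) :+ x :* (y :- con (+ 1))) refl (y i) (x i j))
                (sub-nonNeg (proj₁ (x-bounded i j)) ⊕ *-null (x i j) y≈1)
      , certify (solve 2 (λ y x → con (+ 1) :- y :* x :=
                   (con (+ 1) :- x) :+ (:- x) :* (y :- con (+ 1))) refl (y i) (x i j))
                (sub-nonNeg (proj₂ (x-bounded i j)) ⊕ *-null (- x i j) y≈1)

    -- Each of the `d` coordinates is a mean of numbers in `[−1, 1]`, so its square is at most `1`.
    pull-∙-≤ : ∀ β → pull β ∙ pull β ≤ fromℕ d
    pull-∙-≤ β = ≤-trans
      (sum-mono-≤ (λ j → Bounded-square (mean-Bounded N (λ i → active-Bounded β i j))))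
      (≤-reflexive (trans (sum-const d 1#) (*-identityʳ (fromℕ d))))

    -- The radius of the ball is chosen so that `2λr = √d`: both `2λβ` and `pull β` then have
    -- squared norm at most `d`, and a difference costs a further factor of two.
    ∇F-∙-≤ : ∀ {β} → K β → ∇f β ∙ ∇f β ≤ fromℕ 4 * fromℕ d
    ∇F-∙-≤ {β} β∈ = ≤-trans (∙-self-⊟-≤ (2lam ⊛ β) (pull β)) (certify
      (solve 7 (λ l r s d bb BB hh → con (+ 4) :* d :- con (+ 2) :* (BB :+ hh) :=
         con (+ 2) :* (l :* l) :* (r :* r :- bb) :+ con (+ 2) :* (d :- hh)
         :+ (:- con (+ 2)) :* (BB :- l :* l :* bb)
         :+ (:- (con (+ 2) :* (l :* r :+ s))) :* (l :* r :- s)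
         :+ (:- con (+ 2)) :* (s :* s :- d)) refl
         2lam r √d (fromℕ d) (β ∙ β) ((2lam ⊛ β) ∙ (2lam ⊛ β)) (pull β ∙ pull β))
      (proj₁ 0<2 ⊗ x*x-nonNeg 2lam ⊗ sub-nonNeg (Ball⇒∙-≤ {v = β} β∈)
        ⊕ proj₁ 0<2 ⊗ sub-nonNeg (pull-∙-≤ β)
        ⊕ *-null (- fromℕ 2) (∙-self-⊛ 2lam β)
        ⊕ *-null (- (fromℕ 2 * (2lam * r + √d))) 2lam*r≈√d
        ⊕ *-null (- fromℕ 2) √d²≈d))

    -- Outside 𝒦 the regulariser outweighs the hinge loss along rays, so rescaling onto the
    -- boundary does not increase F.
    F-shrink : ∀ v → ∃ λ u → K u × f u ≤ f v
    F-shrink v with ‖ v ‖ ≤? r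
    ... | yes v∈ = v , v∈ , ≤-refl
    ... | no  v∉ = u , ∙-≤⇒Ball {v = u} 0≤r (≤-reflexive u∙u≈r²) , ≤-trans (certify
        (solve 3 (λ F g q → F :+ g :+ q :- F :=
           g :+ q) refl (f u) (∇f u ∙ (v ⊟ u)) (lam * ((v ⊟ u) ∙ (v ⊟ u))))
        ascent) (F-subgradient u v)
      where
      n = ‖ v ‖
      r<n = ≰⇒> v∉
      0<n : 0# < n
      0<n = ≤-trans 0≤r (proj₁ r<n) , λ 0≈n → <⇒≱ r<n (≤-trans (≤-reflexive (sym 0≈n)) 0≤r)
      c = r / n
      s = 1# - c
      u = c ⊛ v
      h = pull u

      nc≈r : n * c ≈ r
      nc≈r = /-* r 0<n

      0≤s : 0# ≤ s
      0≤s = sub-nonNeg (*-cancelˡ-≤ 0<n (≤-trans (≤-reflexive nc≈r)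
              (≤-trans (proj₁ r<n) (≤-reflexive (sym (*-identityʳ n))))))

      v∙v≈n² : v ∙ v ≈ n * n
      v∙v≈n² = sym (‖‖-square v)

      u∙u≈r² : u ∙ u ≈ r * r
      u∙u≈r² = trans (∙-self-⊛ c v) (trans (*-congˡ v∙v≈n²)
        (trans (solve 2 (λ c n → c :* c :* (n :* n) := n :* c :* (n :* c)) refl c n) (*-cong nc≈r nc≈r)))

      shift : (v ⊟ u) ≋ (s ⊛ v)
      shift j = solve 2 (λ c v → v :- c :* v := (con (+ 1) :- c) :* v) refl c (v j)

      h∙v≤ : h ∙ v ≤ √d * n
      h∙v≤ = ∙-≤ h v 0<√d 0<n (≤-trans (pull-∙-≤ u) (≤-reflexive (sym √d²≈d))) (≤-reflexive v∙v≈n²)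

      gradient : ∇f u ∙ (v ⊟ u) ≈ 2lam * (s * (c * (n * n))) - s * (h ∙ v)
      gradient = trans (∙-cong {u = ∇f u} (λ _ → refl) shift) (trans (∙-⊛ʳ s (∇f u) v)
        (trans (*-congˡ (trans (∇F-∙ u v) (+-congʳ (*-congˡ (trans (∙-⊛ˡ c v v) (*-congˡ v∙v≈n²))))))
          (solve 4 (λ s l q t → s :* (l :* q :- t) :=
             l :* (s :* q) :- s :* t) refl s 2lam (c * (n * n)) (h ∙ v))))

      -- By `n c = r` and `2λr = √d` the expression equals `s (λn(n − r) + (√d n − h ∙ v))`. The
      -- first summand is nonnegative since `r < n`, the second by Cauchy-Schwarz.
      ascent : 0# ≤ ∇f u ∙ (v ⊟ u) + lam * ((v ⊟ u) ∙ (v ⊟ u))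
      ascent = ≤-respʳ-≈ (sym (+-cong gradient
          (*-congˡ (trans (∙-cong shift shift) (trans (∙-self-⊛ s v) (*-congˡ v∙v≈n²))))))
        (≤-respʳ-≈ (solve 6 (λ l n c r q hv →
            (con (+ 1) :- c) :* (l :* n :* (n :- r) :+ (q :* n :- hv)
               :+ l :* n :* (n :* c :- r)
               :+ n :* (con (+ 2) :* l :* r :- q)) :=
            con (+ 2) :* l :* ((con (+ 1) :- c) :* (c :* (n :* n))) :- (con (+ 1) :- c) :* hv
            :+ l :* ((con (+ 1) :- c) :* (con (+ 1) :- c) :* (n :* n)))
            refl lam n c r √d (h ∙ v))
          (0≤s ⊗ (0≤lam ⊗ proj₁ 0<n ⊗ sub-nonNeg (proj₁ r<n) ⊕ sub-nonNeg h∙v≤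
             ⊕ *-null (lam * n) nc≈r ⊕ *-null n 2lam*r≈√d)))

    -- Step sizes against gradient noise.

    -- The denominator of `η`; unlike `η` it involves no inversion of zero at `t = 0`, where the
    -- potential starts.
    κ : ℕ → ℝ
    κ t = fromℕ 8 * lam * √ (fromℕ (d ℕ.* t))

    κ-√ : ∀ t → κ t ≈ fromℕ 8 * lam * (√d * √ (fromℕ t))
    κ-√ t = *-congˡ (trans (√-cong (fromℕ-nonNeg (d ℕ.* t)) (fromℕ-* d t))
                          (√-* (fromℕ-nonNeg d) (fromℕ-nonNeg t)))

    0≤κ : ∀ t → 0# ≤ κ t
    0≤κ t = fromℕ-nonNeg 8 ⊗ 0≤lam ⊗ √-nonNeg _

    κ-pos : ∀ t → .{{NonZero t}} → 0# < κ t
    κ-pos t = <-≤-trans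
      (*-pos (*-pos (<-≤-trans 0<1 (1≤fromℕ 8)) 0<lam) (*-pos 0<√d (<-≤-trans 0<1 (1≤√ t))))
      (≤-reflexive (sym (κ-√ t)))

    lam²D²≈d : lam * lam * D² ≈ fromℕ d
    lam²D²≈d = trans
      (solve 2 (λ l r → l :* l :* (con (+ 4) :* (r :* r)) :=
         (con (+ 2) :* l :* r) :* (con (+ 2) :* l :* r)) refl lam r)
      (trans (*-cong 2lam*r≈√d 2lam*r≈√d) √d²≈d)

    -- √(t+1) - √t ≥ 1/(2 √(t+1)), multiplied out.
    κ-growth : ∀ t → fromℕ 2 * lam ≤ (κ (suc t) - κ t) * √ (fromℕ (suc t))
    κ-growth t = certify
      (solve 7 (λ k′ k l s p′ p t →
         (k′ :- k) :* p′ :- con (+ 2) :* l :=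
         con (+ 4) :* l :* s :* ((p′ :- p) :* (p′ :- p)) :+ con (+ 4) :* l :* (s :- con (+ 1)) :+ con (+ 2) :* l
         :+ p′ :* (k′ :- con (+ 8) :* l :* (s :* p′)) :+ (:- p′) :* (k :- con (+ 8) :* l :* (s :* p))
         :+ (con (+ 4) :* l :* s) :* (p′ :* p′ :- (con (+ 1) :+ t))
         :+ (:- (con (+ 4) :* l :* s)) :* (p :* p :- t))
         refl (κ (suc t)) (κ t) lam √d p′ p (fromℕ t))
      (fromℕ-nonNeg 4 ⊗ 0≤lam ⊗ √-nonNeg _ ⊗ x*x-nonNeg (p′ - p)
        ⊕ fromℕ-nonNeg 4 ⊗ 0≤lam ⊗ sub-nonNeg (1≤√ d) ⊕ proj₁ 0<2lam
        ⊕ *-null p′ (κ-√ (suc t)) ⊕ *-null (- p′) (κ-√ t)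
        ⊕ *-null (fromℕ 4 * lam * √d) (√-square (fromℕ-nonNeg (suc t)))
        ⊕ *-null (- (fromℕ 4 * lam * √d)) (√-square (fromℕ-nonNeg t)))
      where
      p′ = √ (fromℕ (suc t))
      p = √ (fromℕ t)

    -- Both weights on the right are at least `2λ/√(t+1)`, and `(D² − a) + a = D²`, so the right
    -- side is at least `2λD²/√(t+1) = 2d/(λ√(t+1))`. The left side is at most `√d/(2λ√(t+1))`,
    -- which is smaller because `√d ≥ 1`.
    noise-≤ : ∀ t {a G} → 0# ≤ a → a ≤ D² → G ≤ fromℕ 4 * fromℕ d →
              η x y lam (suc t) * G ≤ (κ (suc t) - κ t) * (D² - a) + fromℕ 2 * lam * a
    noise-≤ t {a} {G} 0≤a a≤D² G≤4d = *-cancelˡ-≤ (κ-pos (suc t)) (certify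
      (solve 10 (λ k′ k l s p e a D d G →
         k′ :* ((k′ :- k) :* (D :- a) :+ con (+ 2) :* l :* a) :- k′ :* (e :* G) :=
         con (+ 8) :* l :* s :* ((k′ :- k) :* p :- con (+ 2) :* l) :* (D :- a)
         :+ con (+ 16) :* (l :* l) :* s :* a :* (p :- con (+ 1))
         :+ (con (+ 4) :* d :- G) :+ con (+ 16) :* d :* (s :- con (+ 1)) :+ con (+ 12) :* d
         :+ ((k′ :- k) :* (D :- a) :+ con (+ 2) :* l :* a) :* (k′ :- con (+ 8) :* l :* (s :* p))
         :+ (:- G) :* (k′ :* e :- con (+ 1))
         :+ (con (+ 16) :* s) :* (l :* l :* D :- d)) refl
         (κ (suc t)) (κ t) lam √d p (η x y lam (suc t)) a D² (fromℕ d) G)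
      (fromℕ-nonNeg 8 ⊗ 0≤lam ⊗ √-nonNeg _ ⊗ sub-nonNeg (κ-growth t) ⊗ sub-nonNeg a≤D²
        ⊕ fromℕ-nonNeg 16 ⊗ (0≤lam ⊗ 0≤lam) ⊗ √-nonNeg _ ⊗ 0≤a ⊗ sub-nonNeg (1≤√ (suc t))
        ⊕ sub-nonNeg G≤4d ⊕ fromℕ-nonNeg 16 ⊗ fromℕ-nonNeg d ⊗ sub-nonNeg (1≤√ d)
        ⊕ fromℕ-nonNeg 12 ⊗ fromℕ-nonNeg d
        ⊕ *-null ((κ (suc t) - κ t) * (D² - a) + fromℕ 2 * lam * a) (κ-√ (suc t))
        ⊕ *-null (- G) (/-* 1# (κ-pos (suc t)))
        ⊕ *-null (fromℕ 16 * √d) lam²D²≈d))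
      where
      p = √ (fromℕ (suc t))

    dist²-≤ : ∀ {u v} → K u → K v → (u ⊟ v) ∙ (u ⊟ v) ≤ D²
    dist²-≤ {u} {v} u∈ v∈ = ≤-trans (∙-self-⊟-≤ u v) (certify
      (solve 3 (λ r uu vv → con (+ 4) :* (r :* r) :- con (+ 2) :* (uu :+ vv) :=
         con (+ 2) :* ((r :* r :- uu) :+ (r :* r :- vv))) refl r (u ∙ u) (v ∙ v))
      (proj₁ 0<2 ⊗ (sub-nonNeg (Ball⇒∙-≤ {v = u} u∈) ⊕ sub-nonNeg (Ball⇒∙-≤ {v = v} v∈))))

    -- Jensen's inequality: sum the subgradient inequalities based at the average `m`. Their linear
    -- terms cancel because the iterates sum to `T m`, and the quadratic terms are nonnegative.
    F-average : ∀ (β : ℕ → ℝ^ d) T → .{{NonZero T}} →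
                fromℕ T * f (average β T) ≤ sum {T} (λ t → f (β (toℕ t)))
    F-average β T = certify
      (solve 7 (λ T F S G g ga c → S :- T :* F :=
         (S :- T :* F :- G) :+ con (+ 1) :* (G :- (g :- T :* ga)) :+ (:- T) :* (ga :- c :* g)
         :+ (:- g) :* (T :* c :- con (+ 1))) refl
         (fromℕ T) (f m) (sum {T} (λ t → f (β (toℕ t)))) G g∙Σ (∇f m ∙ m) (1# / fromℕ T))
      (0≤gap ⊕ *-null 1# G≈ ⊕ *-null (- fromℕ T)
          (trans (∙-⊛ʳ (1# / fromℕ T) (∇f m) (vsum {n = T} (λ t → β (toℕ t))))
                 (*-congˡ (∙-vsumʳ {n = T} (∇f m) (λ t → β (toℕ t)))))
        ⊕ *-null (- g∙Σ) (/-* 1# (<-≤-trans 0<1 (1≤fromℕ T))))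
      where
      m = average β T
      G = sum {T} (λ t → ∇f m ∙ (β (toℕ t) ⊟ m))
      g∙Σ = sum {T} (λ t → ∇f m ∙ β (toℕ t))

      G≈ : G ≈ g∙Σ - fromℕ T * (∇f m ∙ m)
      G≈ = trans (sum-cong-≋ {T} (λ t → ∙-⊟ʳ (∇f m) (β (toℕ t)) m))
        (trans (sum-- {T} (λ t → ∇f m ∙ β (toℕ t)) (λ _ → ∇f m ∙ m))
               (+-congˡ (-‿cong (sum-const T (∇f m ∙ m)))))

      0≤gap : 0# ≤ sum {T} (λ t → f (β (toℕ t))) - fromℕ T * f m - G
      0≤gap = ≤-respʳ-≈
        (trans (sum-- {T} (λ t → f (β (toℕ t)) - f m) (λ t → ∇f m ∙ (β (toℕ t) ⊟ m)))
          (+-congʳ (trans (sum-- {T} (λ t → f (β (toℕ t))) (λ _ → f m))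
                         (+-congˡ (-‿cong (sum-const T (f m)))))))
        (sum-nonNeg {T} (λ t → ≤-trans (0≤lam ⊗ ∙-self-nonNeg (β (toℕ t) ⊟ m))
          (certify (solve 4 (λ v F g q → v :- F :- g :- q := v :- (F :+ g :+ q)) refl (f (β (toℕ t))) _ _ _)
            (sub-nonNeg (F-subgradient m (β (toℕ t)))))))

    -- Regret of the iterates and the bound for their average.

    module _ {β : ℕ → ℝ^ d} (gd : IsProjectedGD x y lam β) where
      open IsProjectedGD gd

      iterate∈𝒦 : ∀ t → K (β t)
      iterate∈𝒦 (suc t) = proj₁ (step t)
      iterate∈𝒦 zero    = ∙-≤⇒Ball {v = β 0} 0≤r
        (≤-trans (≤-reflexive (trans (∙-cong {u = β 0} {v = β 0} start start) (∙-zeroˡ {d} 𝟎))) (x*x-nonNeg r))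

      module _ {u : ℝ^ d} (u∈ : K u) where

        dist² : ℕ → ℝ
        dist² t = (β t ⊟ u) ∙ (β t ⊟ u)

        potential : ℕ → ℝ
        potential t = κ t * (D² - dist² t)

        dist²-step : ∀ t → let e = η x y lam (suc t) ; g = ∇f (β t) in
          dist² (suc t) ≤ dist² t - fromℕ 2 * (e * ((β t ⊟ u) ∙ g)) + e * e * (g ∙ g)
        dist²-step t = ≤-trans (projection-nonexpansive (λ {u} → Ball-convex {u = u}) (step t) u∈)
          (≤-reflexive (trans (∙-cong shift shift) (∙-self-⊟⊛ (β t ⊟ u) (η x y lam (suc t)) (∇f (β t)))))
          where
          shift : (β t ⊟ (η x y lam (suc t) ⊛ ∇f (β t)) ⊟ u) ≋ (β t ⊟ u ⊟ (η x y lam (suc t) ⊛ ∇f (β t)))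
          shift j = solve 3 (λ b g u → b :- g :- u := b :- u :- g) refl (β t j) _ (u j)

        -- The increment of the potential is `κ(t+1)(dist² t − dist² (t+1)) + (κ(t+1) − κ t)(D² −
        -- dist² t)`. The first part is at least `2 g ∙ (β t − u) − η‖g‖²` since `κ(t+1) η(t+1) =
        -- 1`; strong convexity leaves a spare `2λ dist² t`, which together with the second part
        -- pays for `η‖g‖²`.
        regret-step : ∀ t → fromℕ 2 * (f (β t) - f u) ≤ potential (suc t) - potential t
        regret-step t = certify
          (solve 12 (λ k′ k l e D a a′ G K K′ Fb Fu →
             k′ :* (D :- a′) :- k :* (D :- a) :- con (+ 2) :* (Fb :- Fu) :=
             -- The summands are, in order: `dist²-step` scaled by `κ (suc t)`, `noise-≤`, and twice
             -- `F-subgradient`; the last two vanish.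
             k′ :* (a :- con (+ 2) :* (e :* K) :+ e :* e :* G :- a′)
             :+ ((k′ :- k) :* (D :- a) :+ con (+ 2) :* l :* a :- e :* G)
             :+ con (+ 2) :* (Fu :- (Fb :+ K′ :+ l :* a))
             :+ con (+ 2) :* (K′ :- (:- K))
             :+ (con (+ 2) :* K :- e :* G) :* (k′ :* e :- con (+ 1)))
             refl (κ (suc t)) (κ t) lam e D² (dist² t) (dist² (suc t)) (g ∙ g)
             ((β t ⊟ u) ∙ g) (g ∙ (u ⊟ β t)) (f (β t)) (f u))
          (0≤κ (suc t) ⊗ sub-nonNeg (dist²-step t)
            ⊕ sub-nonNeg (noise-≤ t (∙-self-nonNeg (β t ⊟ u)) (dist²-≤ {β t} {u} (iterate∈𝒦 t) u∈) (∇F-∙-≤ {β t} (iterate∈𝒦 t)))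
            ⊕ proj₁ 0<2 ⊗ sub-nonNeg (≤-trans (≤-reflexive (+-congˡ (*-congˡ (sym (flip-square)))))
                                              (F-subgradient (β t) u))
            ⊕ *-null (fromℕ 2) flip-gradient
            ⊕ *-null (fromℕ 2 * ((β t ⊟ u) ∙ g) - e * (g ∙ g)) (/-* 1# (κ-pos (suc t))))
          where
          e = η x y lam (suc t)
          g = ∇f (β t)
          negate : (u ⊟ β t) ≋ ((- 1#) ⊛ (β t ⊟ u))
          negate j = solve 2 (λ u b → u :- b := (:- con (+ 1)) :* (b :- u)) refl (u j) (β t j)
          flip-gradient : g ∙ (u ⊟ β t) ≈ - ((β t ⊟ u) ∙ g)
          flip-gradient = trans (∙-comm g (u ⊟ β t)) (trans (∙-cong {v = g} negate (λ _ → refl))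
            (trans (∙-⊛ˡ (- 1#) (β t ⊟ u) g)
              (solve 1 (λ a → (:- con (+ 1)) :* a := :- a) refl ((β t ⊟ u) ∙ g))))
          flip-square : (u ⊟ β t) ∙ (u ⊟ β t) ≈ dist² t
          flip-square = trans (∙-cong negate negate) (trans (∙-self-⊛ (- 1#) (β t ⊟ u))
            (solve 1 (λ a → (:- con (+ 1)) :* (:- con (+ 1)) :* a := a) refl (dist² t)))

        regret : ∀ T → fromℕ 2 * sum {T} (λ t → f (β (toℕ t)) - f u) ≤ κ T * D²
        regret T = ≤-trans
          (≤-reflexive (*-distribˡ-sum {T} (fromℕ 2) (λ t → f (β (toℕ t)) - f u)))
          (≤-trans (sum-telescope T (λ t → fromℕ 2 * (f (β t) - f u)) potential regret-step) (certify
            -- Dropped from the telescoped sum are the final distance term and the initial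
            -- potential, which is nonnegative as both `β 0` and `u` lie in the ball.
            (solve 5 (λ k k₀ D a a₀ → k :* D :- (k :* (D :- a) :- k₀ :* (D :- a₀)) :=
               k :* a :+ k₀ :* (D :- a₀)) refl (κ T) (κ 0) D² (dist² T) (dist² 0))
            (0≤κ T ⊗ ∙-self-nonNeg (β T ⊟ u) ⊕ 0≤κ 0 ⊗ sub-nonNeg (dist²-≤ {β 0} {u} (iterate∈𝒦 0) u∈))))

        suboptimality : ∀ T → .{{NonZero T}} →
          f (average β T) - f u ≤ fromℕ 4 * (fromℕ d * √d) / (lam * √ (fromℕ T))
        -- The factor `2λp²` is `2λT`. It turns averaging and regret into
        -- `2λT (F(average) − F u) ≤ λ κ(T) D²`, and `λ²D² = d` makes the right side `8 d √d p`, the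
        -- same multiple of the claimed bound.
        suboptimality T = *-cancelˡ-≤ (*-pos 0<2 (*-pos 0<lamp 0<p)) (certify
          (solve 11 (λ l p s D d k T A U S Q →
             con (+ 2) :* (l :* p :* p) :* Q :- con (+ 2) :* (l :* p :* p) :* (A :- U) :=
             con (+ 2) :* l :* (S :- T :* A)
             :+ l :* (k :* D :- con (+ 2) :* (S :- T :* U))
             :+ (con (+ 2) :* p) :* (l :* p :* Q :- con (+ 4) :* (d :* s))
             :+ (:- (con (+ 2) :* l :* (A :- U))) :* (p :* p :- T)
             :+ (:- (l :* D)) :* (k :- con (+ 8) :* l :* (s :* p))
             :+ (:- (con (+ 8) :* s :* p)) :* (l :* l :* D :- d))
             refl lam p √d D² (fromℕ d) (κ T) (fromℕ T) (f (average β T)) (f u) S Q)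
          (proj₁ 0<2 ⊗ 0≤lam ⊗ sub-nonNeg (F-average β T)
            ⊕ 0≤lam ⊗ sub-nonNeg (≤-trans (≤-reflexive (*-congˡ (sym sum-gap))) (regret T))
            ⊕ *-null (fromℕ 2 * p) (/-* _ 0<lamp)
            ⊕ *-null (- (fromℕ 2 * lam * (f (average β T) - f u))) (√-square (fromℕ-nonNeg T))
            ⊕ *-null (- (lam * D²)) (κ-√ T)
            ⊕ *-null (- (fromℕ 8 * √d * p)) lam²D²≈d))
          where
          p = √ (fromℕ T)
          S = sum {T} (λ t → f (β (toℕ t)))
          Q = fromℕ 4 * (fromℕ d * √d) / (lam * p)
          0<p : 0# < p
          0<p = <-≤-trans 0<1 (1≤√ T)
          0<lamp : 0# < lam * p
          0<lamp = *-pos 0<lam 0<p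
          sum-gap : sum {T} (λ t → f (β (toℕ t)) - f u) ≈ S - fromℕ T * f u
          sum-gap = trans (sum-- {T} (λ t → f (β (toℕ t))) (λ _ → f u)) (+-congˡ (-‿cong (sum-const T (f u))))

theorem6 :
  (R : Reals) →
  let open Reals R
      open Euclidean R
      open SVM R
  in
  (N d : ℕ) → .{{_ : NonZero N}} → .{{_ : NonZero d}} →
  (x : Fin N → ℝ^ d) → (∀ i j → (- 1# ≤ x i j) × (x i j ≤ 1#)) →
  (y : Fin N → ℝ) → (∀ i → (y i ≈ - 1#) ⊎ (y i ≈ 1#)) →
  (lam : ℝ) → 0# < lam →
  (β* : ℝ^ d) → IsArgMin U (F x y lam) β* →
  (β : ℕ → ℝ^ d) → IsProjectedGD x y lam β →
  (T : ℕ) → .{{_ : NonZero T}} →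
  F x y lam (average β T) - F x y lam β*
    ≤ fromℕ 4 * (fromℕ d * √ (fromℕ d)) / (lam * √ (fromℕ T))
theorem6 R N d x x-bounded y y-label lam 0<lam β* _ β gd T =
  -- The regret bound compares only with points of the ball, so `β*` is replaced by a point `u`
  -- there at which `F` is no larger.
  let u , u∈𝒦 , Fu≤Fβ* = F-shrink x x-bounded y y-label lam 0<lam β*
  in ≤-trans (certify (solve 3 (λ A U V → A :- U :- (A :- V) := V :- U) refl _ (F x y lam u) (F x y lam β*))
                      (sub-nonNeg Fu≤Fβ*))
             (suboptimality x x-bounded y y-label lam 0<lam gd u∈𝒦 T)
  where
  open Reals R
  open SVM R
  open OrderedField R
  open ProjectedSVM R
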